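{- Let $s:\mathbb N\to\mathbb N$ be a strictly increasing function and $\alpha,\beta$ ordinals below $\varepsilon_0$ (with $\beta+1+\alpha<\varepsilon_0$). (i) If $s\in\mathscr F_\beta$, then $\mathbf F_{\alpha,s}\subseteq\mathbf F_{\beta+1+\alpha}$. (ii) If $s(x)\le F_\beta(x)$ for all $x\in\mathbb N$, then $\mathbf F_{\alpha,s}\subseteq\mathbf F_{\beta+\alpha}$.
   Context: Ordinals are below $\varepsilon_0$ in Cantor normal form. Standard fundamental sequences of limit ordinals: $(\gamma+\omega^{\beta+1})(x)=\gamma+\omega^\beta\cdot(x+1)$, $(\gamma+\omega^{\lambda'})(x)=\gamma+\omega^{\lambda'(x)}$ for $\lambda'$ limit. Fast-growing functions: $F_0(x)=x+1$, $F_{\alpha+1}(x)=F_\alpha^{x+1}(x)$, $F_\lambda(x)=F_{\lambda(x)}(x)$. For a monotone $s:\mathbb N\to\mathbb N$, the $s$-fundamental sequences are $(\gamma+\omega^{\beta+1})(x)_s=\gamma+\omega^\beta\cdot s(x)$ and $(\gamma+\omega^{\lambda'})(x)_s=\gamma+\omega^{\lambda'(x)_s}$ for $\lambda'$ limit, and $F_{0,s}(x)=x+1$, $F_{\alpha+1,s}(x)=F_{\alpha,s}^{s(x)}(x)$, $F_{\lambda,s}(x)=F_{\lambda(x)_s,s}(x)$. Extended Grzegorczyk class $\mathscr F_\alpha$: smallest class of functions $\mathbb N^k\to\mathbb N$ containing the zero function, addition, projections and $F_\alpha$ (standard version), closed under composition and limited primitive recursion (primitive recursion bounded by some function of the class applied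 to the max of the arguments). $\mathscr F_{<\alpha}=\bigcup_{\beta<\alpha}\mathscr F_\beta$. $\mathrm{DTime}(t(n))$: languages decided by a deterministic Turing machine in at most $t(n)$ steps on inputs of length $n$. $\mathbf F_\alpha=\bigcup_{p\in\mathscr F_{<\alpha}}\mathrm{DTime}(F_\alpha(p(n)))$ and $\mathbf F_{\alpha,s}=\bigcup_{p\in\mathscr F_{<\alpha}}\mathrm{DTime}(F_{\alpha,s}(p(n)))$, with $p$ unary. -}

module Defs where

open import Data.Nat using (ℕ; zero; suc; _+_; _≤_; _<_; _⊔_)
open import Data.Fin using (Fin; _↑ˡ_) renaming (zero to fz; suc to fs)
open import Data.Vec using (Vec; []; _∷_; lookup; tabulate)
open import Data.List using (List; []; _∷_; length) renaming (map to lmap)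
open import Data.Maybe using (Maybe; just; nothing) renaming (map to mmap)
open import Data.Bool using (Bool; true; false)
open import Data.Product using (Σ; _×_; _,_)
open import Data.Sum using (_⊎_; inj₁; inj₂)
open import Relation.Binary.PropositionalEquality using (_≡_; _≢_)

-- Ordinals below ε₀ in Cantor normal form.
-- ω^ a + b  represents  ω^a + b ; well-formedness (exponents
-- non-increasing, hereditarily) is the predicate CNF below.

data Ord : Set where
  𝟎 : Ord
  ω^_+_ : Ord → Ord → Ord

data Cmp : Set where
  lt eq gt : Cmp

cmp : Ord → Ord → Cmp
cmp 𝟎 𝟎 = eq
cmp 𝟎 (ω^ _ + _) = lt
cmp (ω^ _ + _) 𝟎 = gt
cmp (ω^ a + b) (ω^ c + d) with cmp a c
... | lt = lt
... | gt = gt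
... | eq = cmp b d

_<ₒ_ : Ord → Ord → Set
α <ₒ β = cmp α β ≡ lt

data CNF : Ord → Set where
  cnf0 : CNF 𝟎
  cnf1 : ∀ {a} → CNF a → CNF (ω^ a + 𝟎)
  cnf2 : ∀ {a c d} → CNF a → CNF (ω^ c + d) → cmp a c ≢ lt → CNF (ω^ a + (ω^ c + d))

one : Ord
one = ω^ 𝟎 + 𝟎

_+ₒ_ : Ord → Ord → Ord
𝟎 +ₒ β = β
(ω^ a + b) +ₒ 𝟎 = ω^ a + b
(ω^ a + b) +ₒ (ω^ c + d) with cmp a c
... | lt = ω^ c + d
... | eq = ω^ a + (b +ₒ (ω^ c + d))
... | gt = ω^ a + (b +ₒ (ω^ c + d))

sucₒ : Ord → Ord
sucₒ 𝟎 = one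
sucₒ (ω^ a + b) = ω^ a + sucₒ b

predₒ : Ord → Maybe Ord
predₒ 𝟎 = nothing
predₒ (ω^ 𝟎 + 𝟎) = just 𝟎
predₒ (ω^ (ω^ _ + _) + 𝟎) = nothing
predₒ (ω^ a + (ω^ c + d)) = mmap (ω^ a +_) (predₒ (ω^ c + d))

data IsLimit : Ord → Set where
  lim1 : ∀ c d → IsLimit (ω^ (ω^ c + d) + 𝟎)
  lim2 : ∀ a c d → IsLimit (ω^ c + d) → IsLimit (ω^ a + (ω^ c + d))

ωmul : Ord → ℕ → Ord
ωmul a zero = 𝟎
ωmul a (suc n) = ω^ a + ωmul a n

-- s-fundamental sequences λ(x)_s (junk values on non-limits)
fseq : (ℕ → ℕ) → Ord → ℕ → Ord
fseq s 𝟎 x = 𝟎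
fseq s (ω^ a + 𝟎) x with predₒ a
... | just a' = ωmul a' (s x)
... | nothing = ω^ (fseq s a x) + 𝟎
fseq s (ω^ a + (ω^ c + d)) x = ω^ a + fseq s (ω^ c + d) x

-- Fast-growing hierarchy F_{α,s}, given by its graph:
-- FG s α x y  means  F_{α,s}(x) = y ;  FGIt s α k x y  means  F_{α,s}^k(x) = y.
-- The standard hierarchy F_α is the case s = suc.

mutual
  data FG (s : ℕ → ℕ) : Ord → ℕ → ℕ → Set where
    fg0   : ∀ {x} → FG s 𝟎 x (suc x)
    fgsuc : ∀ {α x y} → FGIt s α (s x) x y → FG s (sucₒ α) x y
    fglim : ∀ {λ' x y} → IsLimit λ' → FG s (fseq s λ' x) x y → FG s λ' x y

  data FGIt (s : ℕ → ℕ) : Ord → ℕ → ℕ → ℕ → Set where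
    it0 : ∀ {α x} → FGIt s α zero x x
    itS : ∀ {α k x y z} → FG s α x y → FGIt s α k y z → FGIt s α (suc k) x z

-- Extended Grzegorczyk classes 𝓕_α (functions ℕ^k → ℕ as Vec ℕ k → ℕ),
-- membership closed under pointwise equality.

maxV : ∀ {n} → Vec ℕ n → ℕ
maxV [] = 0
maxV (x ∷ v) = x ⊔ maxV v

data 𝓕 (α : Ord) : (k : ℕ) → (Vec ℕ k → ℕ) → Set where
  zeroF : ∀ {k} (f : Vec ℕ k → ℕ) → (∀ v → f v ≡ 0) → 𝓕 α k f
  addF  : (f : Vec ℕ 2 → ℕ) → (∀ x y → f (x ∷ y ∷ []) ≡ x + y) → 𝓕 α 2 f
  projF : ∀ {k} (i : Fin k) (f : Vec ℕ k → ℕ) → (∀ v → f v ≡ lookup v i) → 𝓕 α k f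
  baseF : (f : Vec ℕ 1 → ℕ) → (∀ x → FG suc α x (f (x ∷ []))) → 𝓕 α 1 f
  compF : ∀ {k m} (h : Vec ℕ m → ℕ) (g : Fin m → Vec ℕ k → ℕ) (f : Vec ℕ k → ℕ) →
          𝓕 α m h → (∀ i → 𝓕 α k (g i)) →
          (∀ v → f v ≡ h (tabulate (λ i → g i v))) → 𝓕 α k f
  lrecF : ∀ {k} (g : Vec ℕ k → ℕ) (h : Vec ℕ (suc (suc k)) → ℕ) (b : Vec ℕ 1 → ℕ)
          (f : Vec ℕ (suc k) → ℕ) →
          𝓕 α k g → 𝓕 α (suc (suc k)) h → 𝓕 α 1 b →
          (∀ v → f (0 ∷ v) ≡ g v) →
          (∀ y v → f (suc y ∷ v) ≡ h (y ∷ f (y ∷ v) ∷ v)) →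
          (∀ y v → f (y ∷ v) ≤ b (maxV (y ∷ v) ∷ [])) →
          𝓕 α (suc k) f

𝓕< : Ord → (k : ℕ) → (Vec ℕ k → ℕ) → Set
𝓕< α k f = Σ Ord (λ β → CNF β × β <ₒ α × 𝓕 β k f)

-- Deterministic single-tape Turing machines over input alphabet Fin n.
-- Tape alphabet Fin (suc (n + G)): fz is the blank, input symbols embed
-- via fs ∘ inject+ G. Halting is signalled by δ returning inj₂ (answer).

data Move : Set where
  left right stay : Move

record TM (n : ℕ) : Set where
  field
    Q G   : ℕ
    start : Fin Q
    δ     : Fin Q → Fin (suc (n + G)) →
            (Fin Q × Fin (suc (n + G)) × Move) ⊎ Bool

module _ {n : ℕ} (M : TM n) where
  open TM M

  Sym : Set
  Sym = Fin (suc (n + G))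

  record Conf : Set where
    constructor conf
    field
      state : Fin Q
      lft   : List Sym    -- cells left of the head, nearest first
      cur   : Sym
      rgt   : List Sym    -- cells right of the head, nearest first

  inp : Fin n → Sym
  inp a = fs (a ↑ˡ G)

  initConf : List (Fin n) → Conf
  initConf [] = conf start [] fz []
  initConf (a ∷ w) = conf start [] (inp a) (lmap inp w)

  move : Fin Q → List Sym → Sym → List Sym → Move → Conf
  move q l c r stay = conf q l c r
  move q [] c r left = conf q [] fz (c ∷ r)
  move q (c' ∷ l) c r left = conf q l c' (c ∷ r)
  move q l c [] right = conf q (c ∷ l) fz []
  move q l c (c' ∷ r) right = conf q (c ∷ l) c' r

  exec : ℕ → Conf → Maybe Bool
  exec zero _ = nothing
  exec (suc t) (conf q l c r) with δ q c
  ... | inj₂ b = just b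
  ... | inj₁ (q' , c' , m) = exec t (move q' l c' r m)

Lang : ℕ → Set₁
Lang n = List (Fin n) → Set

DecidesWithin : ∀ {n} → TM n → Lang n → List (Fin n) → ℕ → Set
DecidesWithin M L w t =
  Σ Bool (λ b → exec M t (initConf M w) ≡ just b × ((b ≡ true → L w) × (L w → b ≡ true)))

InF : (s : ℕ → ℕ) → Ord → ∀ {n} → Lang n → Set
InF s α {n} L =
  Σ (Vec ℕ 1 → ℕ) λ p → 𝓕< α 1 p ×
  Σ (TM n) λ M → ∀ w → Σ ℕ λ y → FG s α (p (length w ∷ [])) y × DecidesWithin M L w y

{-# OPTIONS --safe #-}
module Submission where

-- The function h = F_β^k satisfies h(x + 1) ≤ F_β(h(x)), and for k large enough also s(x) ≤ h(x).
-- An induction along the computation of F_{α,s}(x) propagates the first inequality to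
-- h(F_{α,s}(x)) ≤ F_{β+α}(h(x)): at successors s(x) ≤ h(x) iterations are performed, and at limits
-- β + λ(x)_s is an ordinal below β + λ with coefficients at most h(x), so that
-- F_{β+λ(x)_s}(h(x)) ≤ F_{β+λ}(h(x)). Since h is bounded by a function of 𝓕_{β+γ} for every γ, it can
-- be absorbed into the inner function p. A function s in 𝓕_β is bounded by an iterate of F_{β+1}.

open import Defs
open import Data.Empty using (⊥-elim)
open import Data.List using (length)
open import Data.Maybe using (just; nothing) renaming (map to mmap)
open import Data.Nat using (ℕ; zero; suc; z≤n; s≤s; _+_; _≤_; _<_; _⊔_)
open import Data.Nat.GeneralisedArithmetic using (iterate)
open import Data.Nat.Properties
open import Data.Fin using (Fin) renaming (zero to fz; suc to fs)
open import Data.Vec using (Vec; []; _∷_; head; lookup; tabulate)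
open import Data.Product using (Σ; _×_; _,_; proj₁; proj₂)
open import Data.Sum using (_⊎_; inj₁; inj₂)
open import Relation.Nullary using (¬_)
open import Relation.Binary.PropositionalEquality using (_≡_; _≢_; refl; sym; trans; cong; subst)

open ≤-Reasoning

private variable
  α β γ δ a b c d : Ord
  k m n x y z : ℕ
  s : ℕ → ℕ

-- Ordering of ordinal terms

infix 4 _≺_

-- An inductive form of `_<ₒ_`, so that comparisons can be taken apart by matching. On terms that
-- are not normal it admits infinite descent (ω, 1 + ω, 1 + 1 + ω, ...), so recursion runs along
-- `Founded` instead.
data _≺_ : Ord → Ord → Set where
  𝟎≺  : 𝟎 ≺ (ω^ a + b)
  hd≺ : a ≺ c → (ω^ a + b) ≺ (ω^ c + d)
  tl≺ : b ≺ d → (ω^ a + b) ≺ (ω^ a + d)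

≺-trans : α ≺ β → β ≺ γ → α ≺ γ
≺-trans 𝟎≺      (hd≺ _) = 𝟎≺
≺-trans 𝟎≺      (tl≺ _) = 𝟎≺
≺-trans (hd≺ p) (hd≺ q) = hd≺ (≺-trans p q)
≺-trans (hd≺ p) (tl≺ _) = hd≺ p
≺-trans (tl≺ _) (hd≺ q) = hd≺ q
≺-trans (tl≺ p) (tl≺ q) = tl≺ (≺-trans p q)

≺-irrefl : ¬ α ≺ α
≺-irrefl (hd≺ p) = ≺-irrefl p
≺-irrefl (tl≺ p) = ≺-irrefl p

≺-asym : α ≺ β → ¬ β ≺ α
≺-asym p q = ≺-irrefl (≺-trans p q)

data CmpSpec (α β : Ord) : Cmp → Set where
  is-lt : α ≺ β → CmpSpec α β lt
  is-eq : α ≡ β → CmpSpec α β eq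
  is-gt : β ≺ α → CmpSpec α β gt

cmp-spec : ∀ α β → CmpSpec α β (cmp α β)
cmp-spec 𝟎 𝟎 = is-eq refl
cmp-spec 𝟎 (ω^ _ + _) = is-lt 𝟎≺
cmp-spec (ω^ _ + _) 𝟎 = is-gt 𝟎≺
cmp-spec (ω^ a + b) (ω^ c + d) with cmp a c | cmp-spec a c
... | lt | is-lt p = is-lt (hd≺ p)
... | gt | is-gt p = is-gt (hd≺ p)
... | eq | is-eq refl with cmp b d | cmp-spec b d
...   | lt | is-lt p = is-lt (tl≺ p)
...   | eq | is-eq refl = is-eq refl
...   | gt | is-gt p = is-gt (tl≺ p)

<ₒ⇒≺ : α <ₒ β → α ≺ β
<ₒ⇒≺ {α} {β} p with cmp α β | cmp-spec α β
<ₒ⇒≺ refl | .lt | is-lt q = q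

≺⇒<ₒ : α ≺ β → α <ₒ β
≺⇒<ₒ {α} {β} p with cmp α β | cmp-spec α β
... | lt | _ = refl
... | eq | is-eq refl = ⊥-elim (≺-irrefl p)
... | gt | is-gt q = ⊥-elim (≺-asym p q)

infix 4 _≼_

_≼_ : Ord → Ord → Set
α ≼ β = α ≡ β ⊎ α ≺ β

≺-≼-trans : α ≺ β → β ≼ γ → α ≺ γ
≺-≼-trans p (inj₁ refl) = p
≺-≼-trans p (inj₂ q) = ≺-trans p q

𝟎≼ : ∀ α → 𝟎 ≼ α
𝟎≼ 𝟎 = inj₁ refl
𝟎≼ (ω^ _ + _) = inj₂ 𝟎≺

tl≼ : b ≼ d → (ω^ a + b) ≼ (ω^ a + d)
tl≼ (inj₁ refl) = inj₁ refl
tl≼ (inj₂ p) = inj₂ (tl≺ p)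

-- Cantor normal forms

-- The side condition of `cnf2`, extended to an empty tail.
data _⊴_ : Ord → Ord → Set where
  𝟎⊴ : 𝟎 ⊴ a
  ω⊴ : c ≼ a → (ω^ c + d) ⊴ a

¬lt⇒≼ : cmp a c ≢ lt → c ≼ a
¬lt⇒≼ {a} {c} p with cmp a c | cmp-spec a c
... | lt | _ = ⊥-elim (p refl)
... | eq | is-eq q = inj₁ (sym q)
... | gt | is-gt q = inj₂ q

≼⇒¬lt : c ≼ a → cmp a c ≢ lt
≼⇒¬lt {c} (inj₁ refl) e = ≺-irrefl (<ₒ⇒≺ {c} {c} e)
≼⇒¬lt {c} {a} (inj₂ p) e = ≺-asym p (<ₒ⇒≺ {a} {c} e)

CNF-cons : CNF a → CNF b → b ⊴ a → CNF (ω^ a + b)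
CNF-cons p cnf0 _ = cnf1 p
CNF-cons p (cnf1 q) (ω⊴ h) = cnf2 p (cnf1 q) (≼⇒¬lt h)
CNF-cons p (cnf2 q r e) (ω⊴ h) = cnf2 p (cnf2 q r e) (≼⇒¬lt h)

CNF-uncons : CNF (ω^ a + b) → CNF a × CNF b × b ⊴ a
CNF-uncons (cnf1 p) = p , cnf0 , 𝟎⊴
CNF-uncons (cnf2 p q e) = p , q , ω⊴ (¬lt⇒≼ e)

tail≺ : CNF (ω^ a + b) → b ≺ (ω^ a + b)
tail≺ (cnf1 _) = 𝟎≺
tail≺ (cnf2 {a} {c} _ q e) with ¬lt⇒≼ {a} {c} e
... | inj₁ refl = tl≺ (tail≺ q)
... | inj₂ p = hd≺ p

CNF-one : CNF one
CNF-one = cnf1 cnf0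

data PlusSpec (a b c d : Ord) : Ord → Set where
  absorb : a ≺ c → PlusSpec a b c d (ω^ c + d)
  append : c ≼ a → PlusSpec a b c d (ω^ a + (b +ₒ (ω^ c + d)))

+-spec : ∀ a b c d → PlusSpec a b c d ((ω^ a + b) +ₒ (ω^ c + d))
+-spec a b c d with cmp a c | cmp-spec a c
... | lt | is-lt p = absorb p
... | eq | is-eq p = append (inj₁ (sym p))
... | gt | is-gt p = append (inj₂ p)

+-identityʳ-ₒ : ∀ α → α +ₒ 𝟎 ≡ α
+-identityʳ-ₒ 𝟎 = refl
+-identityʳ-ₒ (ω^ _ + _) = refl

+-⊴ : b ⊴ a → α ⊴ a → (b +ₒ α) ⊴ a
+-⊴ 𝟎⊴ q = q
+-⊴ {α = 𝟎} (ω⊴ p) q = ω⊴ p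
+-⊴ {b = ω^ e + f} {α = ω^ c + d} (ω⊴ p) q with (ω^ e + f) +ₒ (ω^ c + d) | +-spec e f c d
... | _ | absorb _ = q
... | _ | append _ = ω⊴ p

CNF-+ : CNF α → CNF β → CNF (α +ₒ β)
CNF-+ {𝟎} p q = q
CNF-+ {ω^ a + b} {𝟎} p q = p
CNF-+ {ω^ a + b} {ω^ c + d} p q with CNF-uncons p | (ω^ a + b) +ₒ (ω^ c + d) | +-spec a b c d
... | pa , pb , h | _ | absorb _ = q
... | pa , pb , h | _ | append r = CNF-cons pa (CNF-+ pb q) (+-⊴ h (ω⊴ r))

+-monoʳ-≺ : ∀ β → α ≺ γ → (β +ₒ α) ≺ (β +ₒ γ)
+-monoʳ-≺ 𝟎 p = p
+-monoʳ-≺ {𝟎} {ω^ c + d} (ω^ a + b) p with (ω^ a + b) +ₒ (ω^ c + d) | +-spec a b c d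
... | _ | absorb q = hd≺ q
... | _ | append q = tl≺ (subst (_≺ (b +ₒ (ω^ c + d))) (+-identityʳ-ₒ b) (+-monoʳ-≺ b p))
+-monoʳ-≺ {ω^ e + f} {ω^ c + d} (ω^ a + b) p
  with (ω^ a + b) +ₒ (ω^ e + f) | +-spec a b e f | (ω^ a + b) +ₒ (ω^ c + d) | +-spec a b c d
... | _ | absorb q | _ | absorb r = p
... | _ | append q | _ | absorb r = hd≺ r
... | _ | append q | _ | append r = tl≺ (+-monoʳ-≺ b p)
-- If the smaller summand absorbs the head ω^a, so does the larger; this case and the next are
-- contradictory.
+-monoʳ-≺ (ω^ a + b) (hd≺ p) | _ | absorb q | _ | append r =
  ⊥-elim (≺-irrefl (≺-trans q (≺-≼-trans p r)))
+-monoʳ-≺ (ω^ a + b) (tl≺ p) | _ | absorb q | _ | append r =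
  ⊥-elim (≺-irrefl (≺-≼-trans q r))

m≼m+ₒn : ∀ α β → α ≼ (α +ₒ β)
m≼m+ₒn α β with 𝟎≼ β
... | inj₁ refl = inj₁ (sym (+-identityʳ-ₒ α))
... | inj₂ p = inj₂ (subst (_≺ (α +ₒ β)) (+-identityʳ-ₒ α) (+-monoʳ-≺ α p))

-- Normality enters when the head exponents agree: after cancelling the heads, the tail d of α is to
-- be compared with b + α, and d ≺ α ≼ b + α.
m≼n+ₒm : ∀ α → CNF α → ∀ β → α ≼ (β +ₒ α)
m≼n+ₒm α p 𝟎 = inj₁ refl
m≼n+ₒm 𝟎 p (ω^ a + b) = 𝟎≼ _
m≼n+ₒm (ω^ c + d) p (ω^ a + b) with (ω^ a + b) +ₒ (ω^ c + d) | +-spec a b c d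
... | _ | absorb _ = inj₁ refl
... | _ | append (inj₂ q) = inj₂ (hd≺ q)
... | _ | append (inj₁ refl) = inj₂ (tl≺ (≺-≼-trans (tail≺ p) (m≼n+ₒm (ω^ c + d) p b)))

-- Successors, limits and fundamental sequences

+-sucₒ : ∀ α β → α +ₒ sucₒ β ≡ sucₒ (α +ₒ β)
+-sucₒ 𝟎 β = refl
+-sucₒ (ω^ a + b) 𝟎 with (ω^ a + b) +ₒ one | +-spec a b 𝟎 𝟎
... | _ | append _ = cong (ω^ a +_) (trans (+-sucₒ b 𝟎) (cong sucₒ (+-identityʳ-ₒ b)))
+-sucₒ (ω^ a + b) (ω^ c + d) with cmp a c
... | lt = refl
... | eq = cong (ω^ a +_) (+-sucₒ b (ω^ c + d))
... | gt = cong (ω^ a +_) (+-sucₒ b (ω^ c + d))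

+ₒ-one : ∀ α → α +ₒ one ≡ sucₒ α
+ₒ-one α = trans (+-sucₒ α 𝟎) (cong sucₒ (+-identityʳ-ₒ α))

≺-sucₒ : ∀ α → α ≺ sucₒ α
≺-sucₒ 𝟎 = 𝟎≺
≺-sucₒ (ω^ a + b) = tl≺ (≺-sucₒ b)

≺-sucₒ⇒≼ : ∀ β → α ≺ sucₒ β → α ≼ β
≺-sucₒ⇒≼ 𝟎 𝟎≺ = inj₁ refl
≺-sucₒ⇒≼ (ω^ a + b) 𝟎≺ = inj₂ 𝟎≺
≺-sucₒ⇒≼ (ω^ a + b) (hd≺ p) = inj₂ (hd≺ p)
≺-sucₒ⇒≼ (ω^ a + b) (tl≺ p) = tl≼ (≺-sucₒ⇒≼ b p)

sucₒ≢𝟎 : ∀ α → sucₒ α ≢ 𝟎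
sucₒ≢𝟎 𝟎 ()
sucₒ≢𝟎 (ω^ _ + _) ()

sucₒ-injective : ∀ α β → sucₒ α ≡ sucₒ β → α ≡ β
sucₒ-injective α β e with ≺-sucₒ⇒≼ β (subst (α ≺_) e (≺-sucₒ α))
... | inj₁ p = p
... | inj₂ p with ≺-sucₒ⇒≼ α (subst (β ≺_) (sym e) (≺-sucₒ β))
...   | inj₁ q = sym q
...   | inj₂ q = ⊥-elim (≺-asym p q)

¬limit-sucₒ : ∀ α → ¬ IsLimit (sucₒ α)
¬limit-sucₒ (ω^ a + 𝟎) (lim2 _ _ _ l) = ¬limit-sucₒ 𝟎 l
¬limit-sucₒ (ω^ a + (ω^ c + d)) (lim2 _ _ _ l) = ¬limit-sucₒ (ω^ c + d) l

data View : Ord → Set where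
  is-zero  : View 𝟎
  is-suc   : ∀ α → View (sucₒ α)
  is-limit : IsLimit α → View α

view : ∀ α → View α
view 𝟎 = is-zero
view (ω^ 𝟎 + 𝟎) = is-suc 𝟎
view (ω^ (ω^ c + d) + 𝟎) = is-limit (lim1 c d)
view (ω^ a + (ω^ c + d)) = tail (view (ω^ c + d)) refl
  where
  tail : ∀ {β} → View β → β ≡ ω^ c + d → View (ω^ a + β)
  tail (is-suc γ) _ = is-suc (ω^ a + γ)
  tail (is-limit l) refl = is-limit (lim2 a c d l)

predₒ-tail : ∀ a c d → predₒ (ω^ a + (ω^ c + d)) ≡ mmap (ω^ a +_) (predₒ (ω^ c + d))
predₒ-tail 𝟎 c d = refl
predₒ-tail (ω^ _ + _) c d = refl

predₒ-sucₒ : ∀ α → predₒ (sucₒ α) ≡ just α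
predₒ-sucₒ 𝟎 = refl
predₒ-sucₒ (ω^ a + 𝟎) = predₒ-tail a 𝟎 𝟎
predₒ-sucₒ (ω^ a + (ω^ c + d)) =
  trans (predₒ-tail a c (sucₒ d)) (cong (mmap (ω^ a +_)) (predₒ-sucₒ (ω^ c + d)))

predₒ-limit : IsLimit α → predₒ α ≡ nothing
predₒ-limit (lim1 _ _) = refl
predₒ-limit (lim2 a c d l) = trans (predₒ-tail a c d) (cong (mmap (ω^ a +_)) (predₒ-limit l))

fseq-ω^suc : ∀ s a x → fseq s (ω^ (sucₒ a) + 𝟎) x ≡ ωmul a (s x)
fseq-ω^suc s a x rewrite predₒ-sucₒ a = refl

fseq-ω^limit : ∀ s → IsLimit a → ∀ x → fseq s (ω^ a + 𝟎) x ≡ ω^ (fseq s a x) + 𝟎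
fseq-ω^limit s l x rewrite predₒ-limit l = refl

-- The cases of `fseq` on limits, with its test on `predₒ` replaced by patterns that exhibit the
-- predecessor.
data LimitView : Ord → Set where
  ω^suc   : ∀ a → LimitView (ω^ (sucₒ a) + 𝟎)
  ω^limit : IsLimit a → LimitView (ω^ a + 𝟎)
  tail    : ∀ a c d → IsLimit (ω^ c + d) → LimitView (ω^ a + (ω^ c + d))

limitView : IsLimit α → LimitView α
limitView (lim2 a c d l) = tail a c d l
limitView (lim1 c d) = aux (view (ω^ c + d)) λ ()
  where
  aux : ∀ {a} → View a → a ≢ 𝟎 → LimitView (ω^ a + 𝟎)
  aux is-zero h = ⊥-elim (h refl)
  aux (is-suc a) _ = ω^suc a
  aux (is-limit l) _ = ω^limit l

ωmul-≺ : ∀ k → a ≺ b → ωmul a k ≺ (ω^ b + d)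
ωmul-≺ zero p = 𝟎≺
ωmul-≺ (suc k) p = hd≺ p

ωmul-mono-≼ : ∀ a → k ≤ m → ωmul a k ≼ ωmul a m
ωmul-mono-≼ a z≤n = 𝟎≼ _
ωmul-mono-≼ a (s≤s p) = tl≼ (ωmul-mono-≼ a p)

fseq-≺ : ∀ s → IsLimit α → ∀ x → fseq s α x ≺ α
fseq-≺ s l x = go (limitView l)
  where
  go : LimitView α → fseq s α x ≺ α
  go (ω^suc a) = subst (_≺ _) (sym (fseq-ω^suc s a x)) (ωmul-≺ (s x) (≺-sucₒ a))
  go (ω^limit l) = subst (_≺ _) (sym (fseq-ω^limit s l x)) (hd≺ (fseq-≺ s l x))
  go (tail a c d l) = tl≺ (fseq-≺ s l x)

-- Lean k α: every coefficient in the Cantor normal form of α is at most k, hereditarily.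
data Lean (k : ℕ) : Ord → Set where
  lean𝟎 : Lean k 𝟎
  leanω : Lean k a → Lean k b → (ω^ a + b) ≺ ωmul a (suc k) → Lean k (ω^ a + b)

Lean-mono : k ≤ m → Lean k α → Lean m α
Lean-mono p lean𝟎 = lean𝟎
Lean-mono p (leanω l r q) =
  leanω (Lean-mono p l) (Lean-mono p r) (≺-≼-trans q (ωmul-mono-≼ _ (s≤s p)))

coefficient-bound : CNF b → b ⊴ a → Σ ℕ λ k → b ≺ ωmul a (suc k)
coefficient-bound _ 𝟎⊴ = 0 , 𝟎≺
coefficient-bound p (ω⊴ (inj₂ q)) = 0 , hd≺ q
coefficient-bound p (ω⊴ (inj₁ refl)) with CNF-uncons p
... | _ , pd , h with coefficient-bound pd h
...   | k , q = suc k , tl≺ q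

lean : CNF α → Σ ℕ λ k → Lean k α
lean {𝟎} _ = 0 , lean𝟎
lean {ω^ a + b} p with CNF-uncons p
... | pa , pb , h with lean pa | lean pb | coefficient-bound pb h
...   | k , l | m , r | n , q =
  -- The head adds one to the bound n on the multiplicity of ω^a in the tail; k and m serve the
  -- exponent and the tail.
  suc n + (k + m) ,
  leanω (Lean-mono (≤-trans (m≤m+n k m) (m≤n+m (k + m) (suc n))) l)
        (Lean-mono (≤-trans (m≤n+m m k) (m≤n+m (k + m) (suc n))) r)
        (tl≺ (≺-≼-trans q (ωmul-mono-≼ a (m≤m+n (suc n) (k + m)))))

+-≺-ωmul : ∀ k → b ≺ ωmul a k → α ≺ ωmul a (suc m) → (b +ₒ α) ≺ ωmul a (k + m)
+-≺-ωmul {b} {a} {𝟎} {m} k p q =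
  subst (_≺ _) (sym (+-identityʳ-ₒ b)) (≺-≼-trans p (ωmul-mono-≼ a (m≤m+n k m)))
+-≺-ωmul {𝟎} {a} {ω^ c + d} {m} (suc k) p q =
  ≺-≼-trans q (ωmul-mono-≼ a (s≤s (m≤n+m m k)))
+-≺-ωmul {ω^ e + f} {a} {ω^ c + d} {m} (suc k) p q
  with (ω^ e + f) +ₒ (ω^ c + d) | +-spec e f c d
... | _ | absorb _ = ≺-≼-trans q (ωmul-mono-≼ a (s≤s (m≤n+m m k)))
+-≺-ωmul (suc k) (hd≺ p) q | _ | append r = hd≺ p
+-≺-ωmul (suc k) (tl≺ p) q | _ | append r = tl≺ (+-≺-ωmul k p q)

Lean-+ : Lean k α → Lean m β → Lean (k + m) (α +ₒ β)
Lean-+ {k} lean𝟎 q = Lean-mono (m≤n+m _ k) q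
Lean-+ {β = 𝟎} l@(leanω _ _ _) q = Lean-mono (m≤m+n _ _) l
Lean-+ {k} {ω^ a + b} {m} {ω^ c + d} (leanω l r p) q
  with (ω^ a + b) +ₒ (ω^ c + d) | +-spec a b c d
... | _ | absorb _ = Lean-mono (m≤n+m m k) q
Lean-+ {k} {ω^ a + b} {m} (leanω l r (tl≺ p)) q | _ | append h =
  leanω (Lean-mono (m≤m+n k m) l) (Lean-+ r q) (tl≺ (+-≺-ωmul k p (bound h q)))
  where
  bound : c ≼ a → Lean m (ω^ c + d) → (ω^ c + d) ≺ ωmul a (suc m)
  bound (inj₁ refl) (leanω _ _ q) = q
  bound (inj₂ p) _ = hd≺ p
Lean-+ (leanω l r (hd≺ p)) q | _ | append h = ⊥-elim (≺-irrefl p)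

Lean-pred : ∀ α → Lean k (sucₒ α) → Lean k α
Lean-pred 𝟎 _ = lean𝟎
Lean-pred (ω^ a + b) (leanω l r p) =
  leanω l (Lean-pred b r) (≺-trans (tl≺ (≺-sucₒ b)) p)

Lean-ωmul : ∀ n → n ≤ k → Lean k a → Lean k (ωmul a n)
Lean-ωmul zero _ _ = lean𝟎
Lean-ωmul {k} {a} (suc n) p l =
  leanω l (Lean-ωmul n (≤-trans (n≤1+n n) p) l) (≺-≼-trans (step (suc n)) (ωmul-mono-≼ a (s≤s p)))
  where
  step : ∀ n → ωmul a n ≺ ωmul a (suc n)
  step zero = 𝟎≺
  step (suc n) = tl≺ (step n)

-- The only new large coefficient in λ(x)_s is the factor s(x); all others come from λ.
Lean-fseq : ∀ s → IsLimit α → ∀ x → Lean k α → Lean (k ⊔ s x) (fseq s α x)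
Lean-fseq {α} {k} s l x p = go (limitView l) p
  where
  up : Lean k β → Lean (k ⊔ s x) β
  up = Lean-mono (m≤m⊔n k (s x))
  go : LimitView α → Lean k α → Lean (k ⊔ s x) (fseq s α x)
  go (ω^suc a) (leanω q _ _) = subst (Lean _) (sym (fseq-ω^suc s a x))
    (Lean-ωmul (s x) (m≤n⊔m k (s x)) (up (Lean-pred a q)))
  go (ω^limit l) (leanω q _ h) = subst (Lean _) (sym (fseq-ω^limit s l x))
    (leanω (Lean-fseq s l x q) lean𝟎 (tl≺ (positive k h)))
    where
    -- The new power has coefficient 1, so its bound must be positive; k is positive because ω^a
    -- itself has coefficient 1.
    positive : ∀ {a b} k → (ω^ a + 𝟎) ≺ ωmul a (suc k) → 𝟎 ≺ ωmul b (k ⊔ s x)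
    positive k (hd≺ h) = ⊥-elim (≺-irrefl h)
    positive (suc k) (tl≺ _) with s x
    ... | zero = 𝟎≺
    ... | suc _ = 𝟎≺
  go (tail a c d l) (leanω q r h) =
    leanω (up q) (Lean-fseq s l x r)
      (≺-trans (tl≺ (fseq-≺ s l x)) (≺-≼-trans h (ωmul-mono-≼ a (s≤s (m≤m⊔n k (s x))))))

-- With coefficients at most y, a term below ω^(a+1) stays below ω^a·(y+1), which is exactly the
-- y-th member of the standard sequence. The other cases reduce to this one in the exponent or in
-- the tail.
lean≺fseq : IsLimit α → Lean y δ → δ ≺ α → δ ≺ fseq suc α y
lean≺fseq {α} {y} l p q = go (limitView l) p q
  where
  go : LimitView α → Lean y δ → δ ≺ α → δ ≺ fseq suc α y
  go {δ = δ} (ω^suc a) p q = subst (δ ≺_) (sym (fseq-ω^suc suc a y)) (head-case p q)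
    where
    head-case : Lean y δ → δ ≺ (ω^ (sucₒ a) + 𝟎) → δ ≺ ωmul a (suc y)
    head-case _ 𝟎≺ = 𝟎≺
    head-case (leanω _ _ h) (hd≺ q) with ≺-sucₒ⇒≼ a q
    ... | inj₁ refl = h
    ... | inj₂ r = hd≺ r
  go {δ = δ} (ω^limit {a} l) p q = subst (δ ≺_) (sym (fseq-ω^limit suc l y)) (head-case p q)
    where
    head-case : Lean y δ → δ ≺ (ω^ a + 𝟎) → δ ≺ (ω^ (fseq suc a y) + 𝟎)
    head-case _ 𝟎≺ = 𝟎≺
    head-case (leanω p _ _) (hd≺ q) = hd≺ (lean≺fseq l p q)
  go (tail a c d l) _ 𝟎≺ = 𝟎≺
  go (tail a c d l) _ (hd≺ q) = hd≺ q
  go (tail a c d l) (leanω _ p _) (tl≺ q) = tl≺ (lean≺fseq l p q)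

fseq-tail : ∀ a → IsLimit b → fseq s (ω^ a + b) x ≡ ω^ a + fseq s b x
fseq-tail a (lim1 _ _) = refl
fseq-tail a (lim2 _ _ _ _) = refl

limit-tail : ∀ a → IsLimit b → IsLimit (ω^ a + b)
limit-tail a l@(lim1 c d) = lim2 a _ _ l
limit-tail a l@(lim2 _ _ _ _) = lim2 a _ _ l

limit-ω^suc : ∀ a → IsLimit (ω^ (sucₒ a) + 𝟎)
limit-ω^suc 𝟎 = lim1 _ _
limit-ω^suc (ω^ _ + _) = lim1 _ _

limit-ω^limit : IsLimit a → IsLimit (ω^ a + 𝟎)
limit-ω^limit (lim1 _ _) = lim1 _ _
limit-ω^limit (lim2 _ _ _ _) = lim1 _ _

-- Totality and functionality of the standard hierarchy

-- Accessibility under just the descents that evaluate the standard hierarchy. It holds for every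
-- term, normal or not, and is the recursion principle for `F`.
data Founded : Ord → Set where
  founded-zero  : Founded 𝟎
  founded-suc   : Founded α → Founded (sucₒ α)
  founded-limit : IsLimit α → (∀ x → Founded (fseq suc α x)) → Founded α

founded-cons : Founded (ω^ a + 𝟎) → Founded b → Founded (ω^ a + b)
founded-cons p founded-zero = p
founded-cons p (founded-suc q) = founded-suc (founded-cons p q)
founded-cons {a} p (founded-limit l q) = founded-limit (limit-tail a l) λ x →
  subst Founded (sym (fseq-tail a l)) (founded-cons p (q x))

-- For an exponent a + 1, the sequence consists of finite multiples of ω^a, built by `founded-cons`
-- from the induction hypothesis; for a limit exponent the descent happens in the exponent.
founded-ω^ : Founded a → Founded (ω^ a + 𝟎)
founded-ω^ founded-zero = founded-suc founded-zero
founded-ω^ (founded-suc {a} p) = founded-limit (limit-ω^suc a) λ x →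
  subst Founded (sym (fseq-ω^suc suc a x)) (multiples (suc x))
  where
  multiples : ∀ k → Founded (ωmul a k)
  multiples zero = founded-zero
  multiples (suc k) = founded-cons (founded-ω^ p) (multiples k)
founded-ω^ (founded-limit l p) = founded-limit (limit-ω^limit l) λ x →
  subst Founded (sym (fseq-ω^limit suc l x)) (founded-ω^ (p x))

founded : ∀ α → Founded α
founded 𝟎 = founded-zero
founded (ω^ a + b) = founded-cons (founded-ω^ (founded a)) (founded b)

iterate-graph : {f : ℕ → ℕ} → (∀ x → FG s α x (f x)) → ∀ k → FGIt s α k x (iterate f x k)
iterate-graph p zero = it0
iterate-graph p (suc k) = itS (p _) (iterate-graph p k)

FG-total : Founded α → ∀ x → Σ ℕ (FG suc α x)
FG-total founded-zero x = suc x , fg0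
FG-total (founded-suc p) x = _ , fgsuc (iterate-graph (λ y → proj₂ (FG-total p y)) (suc x))
FG-total (founded-limit l p) x = _ , fglim l (proj₂ (FG-total (p x) x))

-- Opacity stops the evaluation through `founded` from unfolding. The recursion equations of `F` are
-- recovered from its graph and functionality.
opaque
  F : Ord → ℕ → ℕ
  F α x = proj₁ (FG-total (founded α) x)

  F-graph : ∀ α x → FG suc α x (F α x)
  F-graph α x = proj₂ (FG-total (founded α) x)

mutual
  -- The two ordinals are kept apart by an equation because `sucₒ α` is not a constructor form and
  -- could not be unified when both derivations are matched.
  FG-functional : α ≡ β → FG s α x y → FG s β x z → y ≡ z
  FG-functional e fg0 fg0 = refl
  FG-functional e fg0 (fgsuc {α = β} _) = ⊥-elim (sucₒ≢𝟎 β (sym e))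
  FG-functional refl fg0 (fglim () _)
  FG-functional e (fgsuc {α = α} _) fg0 = ⊥-elim (sucₒ≢𝟎 α e)
  FG-functional e (fgsuc {α = α} p) (fgsuc {α = β} q) = FGIt-functional (sucₒ-injective α β e) p q
  FG-functional e (fgsuc {α = α} _) (fglim l _) = ⊥-elim (¬limit-sucₒ α (subst IsLimit (sym e) l))
  FG-functional refl (fglim () _) fg0
  FG-functional e (fglim l _) (fgsuc {α = β} _) = ⊥-elim (¬limit-sucₒ β (subst IsLimit e l))
  FG-functional refl (fglim _ p) (fglim _ q) = FG-functional refl p q

  FGIt-functional : α ≡ β → FGIt s α k x y → FGIt s β k x z → y ≡ z
  FGIt-functional e it0 it0 = refl
  FGIt-functional e (itS p ps) (itS q qs) with FG-functional e p q
  ... | refl = FGIt-functional e ps qs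

F-unique : FG suc α x y → F α x ≡ y
F-unique {α} {x} = FG-functional refl (F-graph α x)

F-zero : ∀ x → F 𝟎 x ≡ suc x
F-zero x = F-unique fg0

F-suc : ∀ α x → F (sucₒ α) x ≡ iterate (F α) x (suc x)
F-suc α x = F-unique (fgsuc (iterate-graph (F-graph α) (suc x)))

F-limit : IsLimit α → ∀ x → F α x ≡ F (fseq suc α x) x
F-limit l x = F-unique (fglim l (F-graph _ x))

-- Iteration of monotone inflationary functions

record Growing (f : ℕ → ℕ) : Set where
  field
    inflationary : ∀ x → x < f x
    monotone     : x ≤ y → f x ≤ f y

open Growing

iterate-+ : ∀ (f : ℕ → ℕ) x k m → iterate f x (k + m) ≡ iterate f (iterate f x k) m
iterate-+ f x zero m = refl
iterate-+ f x (suc k) m = iterate-+ f (f x) k m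

iterate-comm : ∀ (f : ℕ → ℕ) x k → iterate f (f x) k ≡ f (iterate f x k)
iterate-comm f x zero = refl
iterate-comm f x (suc k) = iterate-comm f (f x) k

m+n≤iterate : {f : ℕ → ℕ} → (∀ x → x < f x) → ∀ x k → x + k ≤ iterate f x k
m+n≤iterate i x zero = ≤-reflexive (+-identityʳ x)
m+n≤iterate {f} i x (suc k) = begin
  x + suc k         ≡⟨ +-suc x k ⟩
  suc x + k         ≤⟨ +-monoˡ-≤ k (i x) ⟩
  f x + k           ≤⟨ m+n≤iterate i (f x) k ⟩
  iterate f (f x) k ∎

x≤iterate : {f : ℕ → ℕ} → (∀ x → x < f x) → ∀ x k → x ≤ iterate f x k
x≤iterate i x k = m+n≤o⇒m≤o x (m+n≤iterate i x k)

k≤iterate : {f : ℕ → ℕ} → (∀ x → x < f x) → ∀ x k → k ≤ iterate f x k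
k≤iterate i x k = m+n≤o⇒n≤o x (m+n≤iterate i x k)

iterate-monoʳ : {f : ℕ → ℕ} → (∀ x → x < f x) → ∀ x → k ≤ m → iterate f x k ≤ iterate f x m
iterate-monoʳ i x (z≤n {m}) = x≤iterate i x m
iterate-monoʳ i x (s≤s p) = iterate-monoʳ i _ p

iterate-mono : {f : ℕ → ℕ} → (∀ {x y} → x ≤ y → f x ≤ f y) → ∀ k → x ≤ y →
  iterate f x k ≤ iterate f y k
iterate-mono h zero p = p
iterate-mono h (suc k) p = iterate-mono h k (h p)

-- The first n steps of g lift the argument to at least n, from where on g dominates f.
iterate-≤ : {f g : ℕ → ℕ} → Growing f → Growing g → ∀ n → (∀ y → n ≤ y → f y ≤ g y) →
  ∀ x k → iterate f x k ≤ iterate g x (n + k)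
iterate-≤ {f} {g} gf gg n h x k = begin
  iterate f x k               ≤⟨ iterate-mono (monotone gf) k (x≤iterate (inflationary gg) x n) ⟩
  iterate f (iterate g x n) k ≤⟨ go k (k≤iterate (inflationary gg) x n) ⟩
  iterate g (iterate g x n) k ≡⟨ iterate-+ g x n k ⟨
  iterate g x (n + k)         ∎
  where
  go : ∀ {x} k → n ≤ x → iterate f x k ≤ iterate g x k
  go zero p = ≤-refl
  go {x} (suc k) p = ≤-trans (go k (≤-trans p (<⇒≤ (inflationary gf x))))
    (iterate-mono (monotone gg) k (h x p))

-- Monotonicity of the standard hierarchy

F-inflationary : ∀ α x → x < F α x
F-inflationary α = go (founded α)
  where
  go : ∀ {α} → Founded α → ∀ x → x < F α x
  go founded-zero x = subst (x <_) (sym (F-zero x)) ≤-refl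
  go (founded-suc {α} p) x = begin-strict
    x                       <⟨ n<1+n x ⟩
    suc x                   ≤⟨ k≤iterate (go p) x (suc x) ⟩
    iterate (F α) x (suc x) ≡⟨ F-suc α x ⟨
    F (sucₒ α) x            ∎
  go (founded-limit l p) x = subst (x <_) (sym (F-limit l x)) (go (p x) x)

infix 4 _≼[_]_

-- The pointwise ordering at z: δ is reached from γ by predecessors and λ ↦ λ(z).
data _≼[_]_ (δ : Ord) (z : ℕ) : Ord → Set where
  ≼-refl  : δ ≼[ z ] δ
  ≼-suc   : δ ≼[ z ] γ → δ ≼[ z ] sucₒ γ
  ≼-limit : IsLimit γ → δ ≼[ z ] fseq suc γ z → δ ≼[ z ] γ

≼-trans : α ≼[ z ] β → β ≼[ z ] γ → α ≼[ z ] γ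
≼-trans p ≼-refl = p
≼-trans p (≼-suc q) = ≼-suc (≼-trans p q)
≼-trans p (≼-limit l q) = ≼-limit l (≼-trans p q)

≼-cons : b ≼[ z ] d → (ω^ a + b) ≼[ z ] (ω^ a + d)
≼-cons ≼-refl = ≼-refl
≼-cons (≼-suc p) = ≼-suc (≼-cons p)
≼-cons {a = a} (≼-limit l p) =
  ≼-limit (limit-tail a l) (subst (_ ≼[ _ ]_) (sym (fseq-tail a l)) (≼-cons p))

𝟎≼[] : ∀ α → 𝟎 ≼[ z ] α
𝟎≼[] {z} α = go (founded α)
  where
  go : ∀ {α} → Founded α → 𝟎 ≼[ z ] α
  go founded-zero = ≼-refl
  go (founded-suc p) = ≼-suc (go p)
  go (founded-limit l p) = ≼-limit l (go (p z))

≼-ωmul : ∀ a → k ≤ m → ωmul a k ≼[ z ] ωmul a m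
≼-ωmul a z≤n = 𝟎≼[] _
≼-ωmul a (s≤s p) = ≼-cons (≼-ωmul a p)

-- For a successor exponent, ω^(γ+1) descends to ω^γ·(z+1), which contains at least one copy of ω^γ
-- even at z = 0.
≼-ω^ : a ≼[ z ] c → (ω^ a + 𝟎) ≼[ z ] (ω^ c + 𝟎)
≼-ω^ ≼-refl = ≼-refl
≼-ω^ {z = z} (≼-suc {γ} p) = ≼-trans (≼-ω^ p) (≼-limit (limit-ω^suc γ)
  (subst (_ ≼[ z ]_) (sym (fseq-ω^suc suc γ z)) (≼-ωmul {1} γ (s≤s z≤n))))
≼-ω^ {z = z} (≼-limit l p) =
  ≼-limit (limit-ω^limit l) (subst (_ ≼[ z ]_) (sym (fseq-ω^limit suc l z)) (≼-ω^ p))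

-- Different arguments select different members of the sequence. Since the later member descends to
-- the earlier one at every z, `F` at a limit can be compared at two arguments.
≼-fseq : IsLimit α → x ≤ y → fseq suc α x ≼[ z ] fseq suc α y
≼-fseq {α} {x} {y} {z} l p = go (limitView l)
  where
  go : LimitView α → fseq suc α x ≼[ z ] fseq suc α y
  go (ω^suc a) rewrite fseq-ω^suc suc a x | fseq-ω^suc suc a y = ≼-ωmul a (s≤s p)
  go (ω^limit l) rewrite fseq-ω^limit suc l x | fseq-ω^limit suc l y = ≼-ω^ (≼-fseq l p)
  go (tail a c d l) = ≼-cons (≼-fseq l p)

F-mono-≼ : δ ≼[ z ] γ → F δ z ≤ F γ z
F-mono-≼ ≼-refl = ≤-refl
F-mono-≼ {δ} {z} (≼-suc {γ} p) = begin
  F δ z                   ≤⟨ F-mono-≼ p ⟩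
  F γ z                   ≤⟨ x≤iterate (F-inflationary γ) (F γ z) z ⟩
  iterate (F γ) z (suc z) ≡⟨ F-suc γ z ⟨
  F (sucₒ γ) z            ∎
F-mono-≼ {z = z} (≼-limit l p) = subst (_ ≤_) (sym (F-limit l z)) (F-mono-≼ p)

F-monotone : ∀ α → x ≤ y → F α x ≤ F α y
F-monotone α = go (founded α)
  where
  go : ∀ {α x y} → Founded α → x ≤ y → F α x ≤ F α y
  go {x = x} {y} founded-zero p rewrite F-zero x | F-zero y = s≤s p
  go {x = x} {y} (founded-suc {α} q) p = begin
    F (sucₒ α) x            ≡⟨ F-suc α x ⟩
    iterate (F α) x (suc x) ≤⟨ iterate-mono (go q) (suc x) p ⟩
    iterate (F α) y (suc x) ≤⟨ iterate-monoʳ (F-inflationary α) y (s≤s p) ⟩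
    iterate (F α) y (suc y) ≡⟨ F-suc α y ⟨
    F (sucₒ α) y            ∎
  go {α} {x} {y} (founded-limit l q) p = begin
    F α x              ≡⟨ F-limit l x ⟩
    F (fseq suc α x) x ≤⟨ go (q x) p ⟩
    F (fseq suc α x) y ≤⟨ F-mono-≼ (≼-fseq l p) ⟩
    F (fseq suc α y) y ≡⟨ F-limit l y ⟨
    F α y              ∎

F-growing : ∀ α → Growing (F α)
F-growing α = record { inflationary = F-inflationary α ; monotone = F-monotone α }

-- At a fixed argument F is not monotone in the ordinal: F_5(1) exceeds F_ω(1). Leanness keeps δ
-- below λ(y) at every limit met on the way down from γ.
F-mono-lean : Lean y δ → δ ≼ γ → F δ y ≤ F γ y
F-mono-lean p (inj₁ refl) = ≤-refl
F-mono-lean {y} {δ} {γ} p (inj₂ q) = go (founded γ) q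
  where
  go : ∀ {γ} → Founded γ → δ ≺ γ → F δ y ≤ F γ y
  go (founded-suc {γ} r) q with ≺-sucₒ⇒≼ γ q
  ... | inj₁ refl = F-mono-≼ (≼-suc ≼-refl)
  ... | inj₂ q′ = ≤-trans (go r q′) (F-mono-≼ (≼-suc ≼-refl))
  go (founded-limit l r) q = subst (F δ y ≤_) (sym (F-limit l y)) (go (r y) (lean≺fseq l p q))

-- The relativized hierarchy

mutual
  -- The inequality is weak because s(x) may be 0, and then no iteration takes place.
  FG-inflationary : FG s α x y → x ≤ y
  FG-inflationary fg0 = n≤1+n _
  FG-inflationary (fgsuc p) = FGIt-inflationary p
  FG-inflationary (fglim _ p) = FG-inflationary p

  FGIt-inflationary : FGIt s α k x y → x ≤ y
  FGIt-inflationary it0 = ≤-refl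
  FGIt-inflationary (itS p q) = ≤-trans (FG-inflationary p) (FGIt-inflationary q)

-- The hypothesis on k serves twice: s(x) bounds the number of iterations at successors, and n +
-- s(x) controls the coefficients of β + λ(x)_s at limits.
module Relativization (s : ℕ → ℕ) (β : Ord) {n : ℕ} (lean-β : Lean n β) (k : ℕ)
  (n+s≤h : ∀ x → n + s x ≤ iterate (F β) x k) where

  h : ℕ → ℕ
  h x = iterate (F β) x k

  h-mono : x ≤ y → h x ≤ h y
  h-mono = iterate-mono (F-monotone β) k

  -- A bound m on the coefficients of α is carried along because β + λ(x)_s need not be of the form (β + λ)(z).
  mutual
    FG-semiconjugate : FG s α x y → Lean m α → n + m ≤ h x → h y ≤ F (β +ₒ α) (h x)
    FG-semiconjugate {x = x} fg0 _ _ = begin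
      h (suc x)        ≤⟨ h-mono (F-inflationary β x) ⟩
      h (F β x)        ≡⟨ iterate-comm (F β) x k ⟩
      F β (h x)        ≡⟨ cong (λ γ → F γ (h x)) (+-identityʳ-ₒ β) ⟨
      F (β +ₒ 𝟎) (h x) ∎
    FG-semiconjugate {x = x} {y} (fgsuc {α} p) l q = begin
      h y                                    ≤⟨ FGIt-semiconjugate p (Lean-pred α l) q ⟩
      iterate (F (β +ₒ α)) (h x) (s x)       ≤⟨ iterate-monoʳ (F-inflationary (β +ₒ α)) (h x) s≤1+h ⟩
      iterate (F (β +ₒ α)) (h x) (suc (h x)) ≡⟨ F-suc (β +ₒ α) (h x) ⟨
      F (sucₒ (β +ₒ α)) (h x)                ≡⟨ cong (λ γ → F γ (h x)) (+-sucₒ β α) ⟨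
      F (β +ₒ sucₒ α) (h x)                  ∎
      where
      s≤1+h : s x ≤ suc (h x)
      s≤1+h = m≤n⇒m≤1+n (m+n≤o⇒n≤o n (n+s≤h x))
    FG-semiconjugate {α} {x} {y} {m} (fglim lim p) l q = begin
      h y                       ≤⟨ FG-semiconjugate p l′ lean≤h ⟩
      F (β +ₒ fseq s α x) (h x) ≤⟨ F-mono-lean (Lean-mono lean≤h (Lean-+ lean-β l′))
                                   (inj₂ (+-monoʳ-≺ β (fseq-≺ s lim x))) ⟩
      F (β +ₒ α) (h x)          ∎
      where
      l′ : Lean (m ⊔ s x) (fseq s α x)
      l′ = Lean-fseq s lim x l
      lean≤h : n + (m ⊔ s x) ≤ h x
      lean≤h = subst (_≤ h x) (sym (+-distribˡ-⊔ n m (s x))) (⊔-lub q (n+s≤h x))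

    FGIt-semiconjugate : ∀ {j} → FGIt s α j x y → Lean m α → n + m ≤ h x →
      h y ≤ iterate (F (β +ₒ α)) (h x) j
    FGIt-semiconjugate it0 _ _ = ≤-refl
    FGIt-semiconjugate {α} {x} {y} (itS {k = j} {y = z} p ps) l q = begin
      -- The coefficient bound survives the first step because the argument does not decrease and h
      -- is monotone.
      h y                                ≤⟨ FGIt-semiconjugate ps l (≤-trans q (h-mono (FG-inflationary p))) ⟩
      iterate (F (β +ₒ α)) (h z) j       ≤⟨ iterate-mono (F-monotone (β +ₒ α)) j (FG-semiconjugate p l q) ⟩
      iterate (F (β +ₒ α)) (h x) (suc j) ∎

-- Majorants in the extended Grzegorczyk classes

-- The doubling dominates addition, which F_𝟎 does not.
G : Ord → ℕ → ℕ
G α x = F α (x + x)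

G-growing : ∀ α → Growing (G α)
G-growing α = record
  { inflationary = λ x → ≤-<-trans (m≤m+n x x) (F-inflationary α (x + x))
  ; monotone     = λ p → F-monotone α (+-mono-≤ p p)
  }

F≤G : ∀ α x → F α x ≤ G α x
F≤G α x = F-monotone α (m≤m+n x x)

+≤G : ∀ α x y → x + y ≤ G α (x ⊔ y)
+≤G α x y = ≤-trans (+-mono-≤ (m≤m⊔n x y) (m≤n⊔m x y)) (<⇒≤ (F-inflationary α _))

lookup≤maxV : (v : Vec ℕ n) (i : Fin n) → lookup v i ≤ maxV v
lookup≤maxV (x ∷ v) fz = m≤m⊔n x (maxV v)
lookup≤maxV (x ∷ v) (fs i) = ≤-trans (lookup≤maxV v i) (m≤n⊔m x (maxV v))

maxV-tabulate : (f : Fin n → ℕ) → (∀ i → f i ≤ x) → maxV (tabulate f) ≤ x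
maxV-tabulate {zero} f p = z≤n
maxV-tabulate {suc n} f p = ⊔-lub (p fz) (maxV-tabulate (λ i → f (fs i)) (λ i → p (fs i)))

Majorized : Ord → (Vec ℕ n → ℕ) → ℕ → Set
Majorized α f k = ∀ v → f v ≤ iterate (G α) (maxV v) k

Majorized-mono : {f : Vec ℕ n → ℕ} → k ≤ m → Majorized α f k → Majorized α f m
Majorized-mono {α = α} p q v =
  ≤-trans (q v) (iterate-monoʳ (inflationary (G-growing α)) (maxV v) p)

uniform-majorant : ∀ j (g : Fin j → Vec ℕ n → ℕ) → (∀ i → Σ ℕ (Majorized α (g i))) →
  Σ ℕ λ k → ∀ i → Majorized α (g i) k
uniform-majorant zero g p = 0 , λ ()
uniform-majorant (suc j) g p with p fz | uniform-majorant j (λ i → g (fs i)) (λ i → p (fs i))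
... | k , q | m , r = k ⊔ m , λ where
  fz     → Majorized-mono (m≤m⊔n k m) q
  (fs i) → Majorized-mono (m≤n⊔m k m) (r i)

-- Composition adds the numbers of iterations, and limited recursion inherits the majorant of its
-- bounding function.
majorant : {f : Vec ℕ n → ℕ} → 𝓕 α n f → Σ ℕ (Majorized α f)
majorant (zeroF f e) = 0 , λ v → subst (_≤ _) (sym (e v)) z≤n
majorant {α = α} (addF f e) = 1 , λ where
  (x ∷ y ∷ []) → begin
    f (x ∷ y ∷ [])    ≡⟨ e x y ⟩
    x + y             ≤⟨ +≤G α x y ⟩
    G α (x ⊔ y)       ≡⟨ cong (λ z → G α (x ⊔ z)) (⊔-identityʳ y) ⟨
    G α (x ⊔ (y ⊔ 0)) ∎
majorant (projF i f e) = 0 , λ v → subst (_≤ _) (sym (e v)) (lookup≤maxV v i)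
majorant {α = α} (baseF f e) = 1 , λ where
  (x ∷ []) → begin
    f (x ∷ [])  ≡⟨ F-unique (e x) ⟨
    F α x       ≤⟨ F≤G α x ⟩
    G α x       ≡⟨ cong (G α) (⊔-identityʳ x) ⟨
    G α (x ⊔ 0) ∎
majorant {α = α} (compF {m = j} h g f ph pg e)
  with majorant ph | uniform-majorant j g (λ i → majorant (pg i))
... | k , q | m , r = m + k , λ v → begin
  f v                                             ≡⟨ e v ⟩
  h (tabulate (λ i → g i v))                      ≤⟨ q _ ⟩
  iterate (G α) (maxV (tabulate (λ i → g i v))) k ≤⟨ iterate-mono (monotone (G-growing α)) k
                                                     (maxV-tabulate _ (λ i → r i v)) ⟩
  iterate (G α) (iterate (G α) (maxV v) m) k      ≡⟨ iterate-+ (G α) (maxV v) m k ⟨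
  iterate (G α) (maxV v) (m + k)                  ∎
majorant {α = α} (lrecF g h b f _ _ pb _ _ f≤b) with majorant pb
... | k , q = k , λ where
  (y ∷ v) → begin
    f (y ∷ v)                          ≤⟨ f≤b y v ⟩
    b (maxV (y ∷ v) ∷ [])              ≤⟨ q _ ⟩
    iterate (G α) (maxV (y ∷ v) ⊔ 0) k ≡⟨ cong (λ z → iterate (G α) z k) (⊔-identityʳ (maxV (y ∷ v))) ⟩
    iterate (G α) (maxV (y ∷ v)) k     ∎

unary-majorant : {f : Vec ℕ 1 → ℕ} → 𝓕 α 1 f → Σ ℕ λ k → ∀ x → f (x ∷ []) ≤ iterate (G α) x k
unary-majorant {α} {f} p with majorant p
... | k , q = k , λ x → subst (λ z → f (x ∷ []) ≤ iterate (G α) z k) (⊔-identityʳ x) (q (x ∷ []))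

𝓕-∘ : (f g : ℕ → ℕ) → 𝓕 α 1 (λ v → f (head v)) → 𝓕 α 1 (λ v → g (head v)) →
  𝓕 α 1 (λ v → f (g (head v)))
𝓕-∘ f g p q = compF (λ v → f (head v)) (λ _ v → g (head v)) _ p (λ _ → q) (λ _ → refl)

𝓕-id : 𝓕 α 1 head
𝓕-id = projF fz head λ where (_ ∷ []) → refl

𝓕-F : 𝓕 α 1 (λ v → F α (head v))
𝓕-F {α} = baseF _ (F-graph α)

𝓕-G : 𝓕 α 1 (λ v → G α (head v))
𝓕-G {α} = 𝓕-∘ (F α) (λ x → x + x) 𝓕-F (compF (λ v → lookup v fz + lookup v (fs fz)) (λ _ → head) _
  (addF _ (λ _ _ → refl)) (λ _ → 𝓕-id) (λ _ → refl))

𝓕-iterate : (f : ℕ → ℕ) → 𝓕 α 1 (λ v → f (head v)) → ∀ k → 𝓕 α 1 (λ v → iterate f (head v) k)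
𝓕-iterate f p zero = 𝓕-id
𝓕-iterate f p (suc k) = 𝓕-∘ (λ x → iterate f x k) f (𝓕-iterate f p k) p

-- One application of F_{β+1} performs the doubling, since it makes x + 1 increasing steps from x,
-- and a second one dominates F_β. Each `G β` thus costs two applications.
iterate-G≤iterate-F : ∀ β x k → iterate (G β) x k ≤ iterate (F (sucₒ β)) x (k + k)
iterate-G≤iterate-F β x zero = ≤-refl
iterate-G≤iterate-F β x (suc k) rewrite +-suc k k = begin
  iterate (G β) (G β x) k                   ≤⟨ iterate-mono (monotone (G-growing β)) k G≤F∘F ⟩
  iterate (G β) (F β+1 (F β+1 x)) k         ≤⟨ iterate-G≤iterate-F β _ k ⟩
  iterate (F β+1) (F β+1 (F β+1 x)) (k + k) ∎
  where
  β+1 : Ord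
  β+1 = sucₒ β
  double≤F : x + x ≤ F β+1 x
  double≤F = begin
    x + x                   ≤⟨ +-monoʳ-≤ x (n≤1+n x) ⟩
    x + suc x               ≤⟨ m+n≤iterate (F-inflationary β) x (suc x) ⟩
    iterate (F β) x (suc x) ≡⟨ F-suc β x ⟨
    F β+1 x                 ∎
  G≤F∘F : G β x ≤ F β+1 (F β+1 x)
  G≤F∘F = ≤-trans (F-mono-≼ (≼-suc ≼-refl)) (F-monotone β+1 double≤F)

-- Time-bounded languages

exec-mono : ∀ {n} (M : TM n) {t t′} (C : Conf M) {b} → t ≤ t′ →
  exec M t C ≡ just b → exec M t′ C ≡ just b
exec-mono M (conf q l c r) (s≤s p) e with TM.δ M q c
... | inj₂ _ = e
... | inj₁ (q′ , c′ , mv) = exec-mono M (move M q′ l c′ r mv) p e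

DecidesWithin-mono : ∀ {n} (M : TM n) (L : Lang n) w {t t′} → t ≤ t′ →
  DecidesWithin M L w t → DecidesWithin M L w t′
DecidesWithin-mono M L w p (b , e , q) = b , exec-mono M (initConf M w) p e , q

-- The machine is kept and only its clock changes. The new inner function is an iterate of `G` at β
-- + γ: it dominates h ∘ p and lies in a class below β + α, since γ is below α.
InF-relativized : ∀ {n} {L : Lang n} → CNF α → CNF β → (∀ x → s x ≤ iterate (F β) x k) →
  InF s α L → InF suc (β +ₒ α) L
InF-relativized {α} {β} {s} {k} {L = L} cα cβ s≤ (p , (γ , cγ , γ<α , p∈𝓕γ) , M , decides) =
  (λ v → iterate (G β+γ) (head v) K) ,
  (β+γ , CNF-+ cβ cγ , ≺⇒<ₒ (+-monoʳ-≺ β (<ₒ⇒≺ γ<α)) , 𝓕-iterate (G β+γ) 𝓕-G K) ,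
  M , λ w → _ , F-graph (β +ₒ α) _ , decides′ w
  where
  β+γ : Ord
  β+γ = β +ₒ γ
  nα nβ nγ kₚ kₕ K : ℕ
  nα = proj₁ (lean cα)
  nβ = proj₁ (lean cβ)
  nγ = proj₁ (lean cγ)
  kₚ = proj₁ (unary-majorant p∈𝓕γ)
  -- The extra iterations add at least nβ + nα to the value, which pays for the coefficients of β
  -- and α.
  kₕ = k + (nβ + nα)

  h≥ : ∀ x → iterate (F β) x k + (nβ + nα) ≤ iterate (F β) x kₕ
  h≥ x = subst (iterate (F β) x k + (nβ + nα) ≤_) (sym (iterate-+ (F β) x k (nβ + nα)))
    (m+n≤iterate (F-inflationary β) (iterate (F β) x k) (nβ + nα))

  nβ+s≤h : ∀ x → nβ + s x ≤ iterate (F β) x kₕ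
  nβ+s≤h x = begin
    nβ + s x                      ≤⟨ +-mono-≤ (m≤m+n nβ nα) (s≤ x) ⟩
    (nβ + nα) + iterate (F β) x k ≡⟨ +-comm (nβ + nα) _ ⟩
    iterate (F β) x k + (nβ + nα) ≤⟨ h≥ x ⟩
    iterate (F β) x kₕ            ∎

  open Relativization s β (proj₂ (lean cβ)) kₕ nβ+s≤h

  -- `G γ` and `F β` are dominated by `G β+γ` only from nγ and nβ on; these summands are the warm-up
  -- steps of `iterate-≤`.
  K = (nγ + kₚ) + (nβ + kₕ)

  h∘p≤ : ∀ x → h (p (x ∷ [])) ≤ iterate (G β+γ) x K
  h∘p≤ x = begin
    h (p (x ∷ []))                                          ≤⟨ h-mono (proj₂ (unary-majorant p∈𝓕γ) x) ⟩
    h (iterate (G γ) x kₚ)                                  ≤⟨ h-mono (iterate-≤ (G-growing γ) (G-growing β+γ)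
          nγ Gγ≤G x kₚ) ⟩
    h (iterate (G β+γ) x (nγ + kₚ))                         ≤⟨ iterate-≤ (F-growing β) (G-growing β+γ)
          nβ Fβ≤G _ kₕ ⟩
    iterate (G β+γ) (iterate (G β+γ) x (nγ + kₚ)) (nβ + kₕ) ≡⟨ iterate-+ (G β+γ) x (nγ + kₚ) (nβ + kₕ) ⟨
    iterate (G β+γ) x K                                     ∎
    where
    Gγ≤G : ∀ y → nγ ≤ y → G γ y ≤ G β+γ y
    Gγ≤G y q = F-mono-lean (Lean-mono (≤-trans q (m≤m+n y y)) (proj₂ (lean cγ))) (m≼n+ₒm γ cγ β)
    Fβ≤G : ∀ y → nβ ≤ y → F β y ≤ G β+γ y
    Fβ≤G y q = ≤-trans (F-mono-lean (Lean-mono q (proj₂ (lean cβ))) (m≼m+ₒn β γ)) (F≤G β+γ y)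

  decides′ : ∀ w → DecidesWithin M L w (F (β +ₒ α) (iterate (G β+γ) (length w) K))
  decides′ w with decides w
  ... | y , Fpw≡y , d = DecidesWithin-mono M L w y≤ d
    where
    pw : ℕ
    pw = p (length w ∷ [])
    y≤ : y ≤ F (β +ₒ α) (iterate (G β+γ) (length w) K)
    y≤ = begin
      y                                         ≤⟨ x≤iterate (F-inflationary β) y kₕ ⟩
      h y                                       ≤⟨ FG-semiconjugate Fpw≡y (proj₂ (lean cα))
                                                   (m+n≤o⇒n≤o (iterate (F β) pw k) (h≥ pw)) ⟩
      F (β +ₒ α) (h pw)                         ≤⟨ F-monotone (β +ₒ α) (h∘p≤ (length w)) ⟩
      F (β +ₒ α) (iterate (G β+γ) (length w) K) ∎

theorem4p4 : (s : ℕ → ℕ) → (∀ {x y} → x < y → s x < s y) →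
    (α β : Ord) → CNF α → CNF β →
    (𝓕 β 1 (λ v → s (head v)) →
    ∀ {n} (L : Lang n) → InF s α L → InF suc ((β +ₒ one) +ₒ α) L)
    ×
    ((∀ x → Σ ℕ (λ y → FG suc β x y × s x ≤ y)) →
    ∀ {n} (L : Lang n) → InF s α L → InF suc (β +ₒ α) L)
theorem4p4 s _ α β cα cβ = part-i , part-ii
  where
  part-i : 𝓕 β 1 (λ v → s (head v)) →
    ∀ {n} (L : Lang n) → InF s α L → InF suc ((β +ₒ one) +ₒ α) L
  part-i s∈𝓕β L with unary-majorant s∈𝓕β
  -- The majorant of `s` consists of k applications of `G β`, hence 2k of F_{β+1}; the
  -- relativization is applied with β + 1 in place of β.
  ... | k , s≤ = InF-relativized {k = k + k} cα (CNF-+ cβ CNF-one) λ x →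
    subst (λ γ → s x ≤ iterate (F γ) x (k + k)) (sym (+ₒ-one β))
      (≤-trans (s≤ x) (iterate-G≤iterate-F β x k))
  part-ii : (∀ x → Σ ℕ (λ y → FG suc β x y × s x ≤ y)) →
    ∀ {n} (L : Lang n) → InF s α L → InF suc (β +ₒ α) L
  part-ii s≤Fβ L = InF-relativized {k = 1} cα cβ λ x → s≤F x (s≤Fβ x)
    where
    s≤F : ∀ x → Σ ℕ (λ y → FG suc β x y × s x ≤ y) → s x ≤ F β x
    s≤F x (y , p , q) = subst (s x ≤_) (sym (F-unique p)) q
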